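{- Let $m,n\in\mathbb{N}$ with $m\ge 1$. If $m$ and $n$ are both even, $m\mid 3n$, and $4\nmid n$, then the friendship graph $F_n$ is not $\mathbb{Z}_m$-cordial.
   Context: Graphs are finite, simple and undirected. For $n\in\mathbb{N}$, the friendship graph $F_n$ is the union of $n$ copies of the triangle $C_3$ joined at a single common (central) vertex. For an abelian group $A$ and a graph $G=(V,E)$, a vertex labeling $\ell:V\to A$ induces an edge labeling $\ell(\{v_1,v_2\})=\ell(v_1)+\ell(v_2)$. Let $f_V(a)=|\{v\in V:\ell(v)=a\}|$ and $f_E(a)=|\{e\in E:\ell(e)=a\}|$. The labeling is $A$-cordial if $|f_V(a_1)-f_V(a_2)|\le 1$ and $|f_E(a_1)-f_E(a_2)|\le 1$ for all $a_1,a_2\in A$; $G$ is $A$-cordial if it admits an $A$-cordial labeling. -}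

module Defs where

open import Algebra.Bundles using (AbelianGroup)
open import Algebra.Structures using (IsAbelianGroup)
open import Data.Fin using (Fin; toℕ)
open import Data.Fin.Properties using (toℕ-injective; toℕ-fromℕ<; toℕ<n; toℕ≤n) renaming (_≟_ to _≟F_)
open import Data.List using (List; []; _∷_; _++_; map; filter; length; allFin; cartesianProductWith)
open import Data.List.Membership.Propositional using (_∈_)
open import Data.List.Membership.Propositional.Properties using (∈-allFin; ∈-cartesianProductWith⁺)
open import Data.List.Relation.Unary.All.Properties using () renaming (cartesianProductWith⁺ to All-cartesianProductWith⁺)
open import Data.List.Relation.Unary.AllPairs using (_∷_)
open import Data.List.Relation.Unary.Any using (here; there)
open import Data.List.Relation.Unary.Unique.Propositional using (Unique)
open import Data.List.Relation.Unary.Unique.Propositional.Properties using (allFin⁺; cartesianProductWith⁺)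
open import Data.Nat using (ℕ; _+_; _∸_; _≤_; ∣_-_∣; NonZero; >-nonZero⁻¹)
open import Data.Nat.DivMod using (_%_; _mod_; m%n<n; %-distribˡ-+; m%n%n≡m%n; m<n⇒m%n≡m; n%n≡0)
open import Data.Nat.Properties using (+-comm; +-assoc; m∸n+n≡m)
open import Data.Product using (∃; _×_; _,_)
open import Level using (0ℓ)
open import Relation.Binary using (Rel; Decidable; Symmetric)
open import Relation.Binary.PropositionalEquality
  using (_≡_; _≢_; refl; sym; trans; cong; cong₂; isEquivalence; setoid; ≢-sym; module ≡-Reasoning)
open import Relation.Nullary using (¬_; yes; no)

-- For a duplicate-free list this enumerates the 2-element subsets of its set
-- of entries, each of them exactly once (as the pair in list order).
pairs : ∀ {A : Set} → List A → List (A × A)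
pairs []       = []
pairs (x ∷ xs) = map (x ,_) xs ++ pairs xs

record Graph : Set₁ where
  infix 4 _~_ _~?_
  field
    Vertex   : Set
    _~_      : Rel Vertex 0ℓ
    ~-sym    : Symmetric _~_
    ~-irrefl : ∀ {v} → ¬ (v ~ v)
    _~?_     : Decidable _~_
    vertices : List Vertex
    unique   : Unique vertices
    complete : ∀ v → v ∈ vertices

  edges : List (Vertex × Vertex)
  edges = filter (λ (u , v) → u ~? v) (pairs vertices)

-- Decidability of the equality of A is what makes the sets being counted
-- finite in the constructive sense.
module _ {c ℓ} (A : AbelianGroup c ℓ) (_≟_ : Decidable (AbelianGroup._≈_ A)) (G : Graph) where
  open AbelianGroup A using (Carrier; _∙_)
  open Graph G

  f-V : (Vertex → Carrier) → Carrier → ℕ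
  f-V lab a = length (filter (λ v → lab v ≟ a) vertices)

  f-E : (Vertex → Carrier) → Carrier → ℕ
  f-E lab a = length (filter (λ (u , v) → (lab u ∙ lab v) ≟ a) edges)

  IsCordialLabeling : (Vertex → Carrier) → Set c
  IsCordialLabeling lab =
      (∀ a₁ a₂ → ∣ f-V lab a₁ - f-V lab a₂ ∣ ≤ 1)
    × (∀ a₁ a₂ → ∣ f-E lab a₁ - f-E lab a₂ ∣ ≤ 1)

  Cordial : Set c
  Cordial = ∃ IsCordialLabeling

-- The k-th triangle has the vertices hub, rim k 0 and rim k 1.
data FVertex (n : ℕ) : Set where
  hub : FVertex n
  rim : Fin n → Fin 2 → FVertex n

data FAdj {n : ℕ} : Rel (FVertex n) 0ℓ where
  hub-rim : ∀ {k i} → FAdj hub (rim k i)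
  rim-hub : ∀ {k i} → FAdj (rim k i) hub
  rim-rim : ∀ {k i j} → i ≢ j → FAdj (rim k i) (rim k j)

private
  FAdj-sym : ∀ {n} → Symmetric (FAdj {n})
  FAdj-sym hub-rim       = rim-hub
  FAdj-sym rim-hub       = hub-rim
  FAdj-sym (rim-rim i≢j) = rim-rim (≢-sym i≢j)

  FAdj-irrefl : ∀ {n} {v : FVertex n} → ¬ FAdj v v
  FAdj-irrefl (rim-rim i≢i) = i≢i refl

FAdj? : ∀ {n} → Decidable (FAdj {n})
FAdj? hub       hub       = no λ ()
FAdj? hub       (rim _ _) = yes hub-rim
FAdj? (rim _ _) hub       = yes rim-hub
FAdj? (rim k i) (rim l j) with k ≟F l | i ≟F j
... | no k≢l   | _        = no λ { (rim-rim _) → k≢l refl }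
... | yes refl | yes refl = no FAdj-irrefl
... | yes refl | no i≢j   = yes (rim-rim i≢j)

F-vertices : ∀ n → List (FVertex n)
F-vertices n = hub ∷ cartesianProductWith rim (allFin n) (allFin 2)

private
  F-unique : ∀ n → Unique (F-vertices n)
  F-unique n =
    All-cartesianProductWith⁺ (setoid _) (setoid _) rim (allFin n) (allFin 2) (λ _ _ ())
    ∷ cartesianProductWith⁺ rim (λ { refl → refl , refl }) (allFin⁺ n) (allFin⁺ 2)

  F-complete : ∀ {n} (v : FVertex n) → v ∈ F-vertices n
  F-complete hub       = here refl
  F-complete (rim k i) = there (∈-cartesianProductWith⁺ rim (∈-allFin k) (∈-allFin i))

friendship : ℕ → Graph
friendship n = record
  { Vertex   = FVertex n
  ; _~_      = FAdj
  ; ~-sym    = FAdj-sym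
  ; ~-irrefl = FAdj-irrefl
  ; _~?_     = FAdj?
  ; vertices = F-vertices n
  ; unique   = F-unique n
  ; complete = F-complete
  }

module _ (m : ℕ) .{{_ : NonZero m}} where

  addMod : Fin m → Fin m → Fin m
  addMod i j = (toℕ i + toℕ j) mod m

  negMod : Fin m → Fin m
  negMod i = (m ∸ toℕ i) mod m

  private
    toℕ-mod : ∀ a → toℕ (a mod m) ≡ a % m
    toℕ-mod a = toℕ-fromℕ< (m%n<n a m)

    mod-cong : ∀ {a b} → a % m ≡ b % m → a mod m ≡ b mod m
    mod-cong {a} {b} eq = toℕ-injective (trans (toℕ-mod a) (trans eq (sym (toℕ-mod b))))

    absorbˡ : ∀ a b → (a % m + b) % m ≡ (a + b) % m
    absorbˡ a b = begin
      (a % m + b) % m         ≡⟨ %-distribˡ-+ (a % m) b m ⟩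
      (a % m % m + b % m) % m ≡⟨ cong (λ x → (x + b % m) % m) (m%n%n≡m%n a m) ⟩
      (a % m + b % m) % m     ≡⟨ %-distribˡ-+ a b m ⟨
      (a + b) % m             ∎
      where open ≡-Reasoning

    add-comm : ∀ i j → addMod i j ≡ addMod j i
    add-comm i j = cong (_mod m) (+-comm (toℕ i) (toℕ j))

    toℕ-add-mod : ∀ a (k : Fin m) → addMod (a mod m) k ≡ (a + toℕ k) mod m
    toℕ-add-mod a k = mod-cong (trans (cong (λ x → (x + toℕ k) % m) (toℕ-mod a)) (absorbˡ a (toℕ k)))

    add-assoc : ∀ i j k → addMod (addMod i j) k ≡ addMod i (addMod j k)
    add-assoc i j k = begin
      addMod (addMod i j) k             ≡⟨ toℕ-add-mod (toℕ i + toℕ j) k ⟩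
      (toℕ i + toℕ j + toℕ k) mod m     ≡⟨ cong (_mod m) (+-assoc (toℕ i) (toℕ j) (toℕ k)) ⟩
      (toℕ i + (toℕ j + toℕ k)) mod m   ≡⟨ cong (_mod m) (+-comm (toℕ i) (toℕ j + toℕ k)) ⟩
      ((toℕ j + toℕ k) + toℕ i) mod m   ≡⟨ toℕ-add-mod (toℕ j + toℕ k) i ⟨
      addMod (addMod j k) i             ≡⟨ add-comm (addMod j k) i ⟩
      addMod i (addMod j k)             ∎
      where open ≡-Reasoning

    add-identityˡ : ∀ i → addMod (0 mod m) i ≡ i
    add-identityˡ i = trans (toℕ-add-mod 0 i)
      (toℕ-injective (trans (toℕ-mod (toℕ i)) (m<n⇒m%n≡m (toℕ<n i))))

    add-inverseˡ : ∀ i → addMod (negMod i) i ≡ 0 mod m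
    add-inverseˡ i = trans (toℕ-add-mod (m ∸ toℕ i) i) (mod-cong (begin
      (m ∸ toℕ i + toℕ i) % m ≡⟨ cong (_% m) (m∸n+n≡m (toℕ≤n i)) ⟩
      m % m                   ≡⟨ n%n≡0 m ⟩
      0                       ≡⟨ m<n⇒m%n≡m (>-nonZero⁻¹ m) ⟨
      0 % m                   ∎))
      where open ≡-Reasoning

    isAbelianGroup : IsAbelianGroup _≡_ addMod (0 mod m) negMod
    isAbelianGroup = record
      { isGroup = record
        { isMonoid = record
          { isSemigroup = record
            { isMagma = record { isEquivalence = isEquivalence ; ∙-cong = cong₂ addMod }
            ; assoc   = add-assoc
            }
          ; identity = add-identityˡ , λ i → trans (add-comm i _) (add-identityˡ i)
          }
        ; inverse = add-inverseˡ , λ i → trans (add-comm i _) (add-inverseˡ i)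
        ; ⁻¹-cong = cong negMod
        }
      ; comm = add-comm
      }

  ℤ/ : AbelianGroup 0ℓ 0ℓ
  ℤ/ = record
    { Carrier        = Fin m
    ; _≈_            = _≡_
    ; _∙_            = addMod
    ; ε              = 0 mod m
    ; _⁻¹            = negMod
    ; isAbelianGroup = isAbelianGroup
    }

{-# OPTIONS --safe #-}

-- If m divides the number 3n of edges, a cordial labeling takes every edge
-- label equally often, say q times, so the edge labels (as residues below m)
-- have the sum S = q · m(m-1)/2, that is 2S + 3n = 3nm. Around a triangle with
-- labels h, x, y the edge labels sum to 2(h + x + y), and reduction modulo the
-- even number m preserves parity, so S is even. As 4 ∣ nm, this forces 4 ∣ 3n, so 4 ∣ n.

module Submission where

open import Defs
open import Data.Fin.Properties using (_≟_)
open import Data.Nat using (ℕ; _*_; NonZero)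
open import Data.Nat.Divisibility using (_∣_; _∤_)
open import Relation.Nullary using (¬_)

open import Data.Bool using (true; false; if_then_else_)
open import Data.Fin using (Fin; zero; suc; toℕ)
open import Data.Fin.Patterns using (0F; 1F)
open import Data.Fin.Properties using (toℕ-fromℕ<)
open import Data.List using (List; []; _∷_; _++_; map; filter; length; allFin; cartesianProductWith)
open import Data.List.Properties using (filter-all; filter-none; filter-accept; filter-++; map-++; length-tabulate)
open import Data.List.Relation.Unary.All using (All; []; _∷_; lookup)
open import Data.List.Relation.Unary.All.Properties using (map⁺) renaming (cartesianProductWith⁺ to All-cartesianProductWith⁺)
open import Data.List.Relation.Unary.AllPairs using ([]; _∷_)
open import Data.List.Relation.Unary.Unique.Propositional using (Unique)
open import Data.List.Relation.Unary.Unique.Propositional.Properties using (allFin⁺)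
open import Data.Nat using (zero; suc; _+_; _≤_; _<_; z≤n; s≤s⁻¹; ∣_-_∣)
open import Data.Nat.Coprimality using (coprime?; coprime-divisor)
open import Data.Nat.DivMod using (_/_; _mod_; m%n<n; m≡m%n+[m/n]*n)
open import Data.Nat.Divisibility using (divides; m∣m*n; ∣n⇒∣m*n; ∣m∣n⇒∣m+n; ∣m+n∣m⇒∣n; _∣0; *-monoʳ-∣; *-pres-∣)
open import Data.Nat.ListAction using () renaming (sum to sumᴸ)
open import Data.Nat.ListAction.Properties using (sum-++)
open import Data.Nat.Properties
  using (+-*-semiring; +-mono-≤; +-mono-<-≤; +-mono-≤-<; ≤-antisym; ≤-trans; ≤-reflexive; ≤⇒≯; ≮⇒≥;
         n<1+n; +-monoʳ-≤; *-cancelˡ-<; +-comm; +-identityʳ; *-comm; *-assoc; *-identityʳ; m≤n+∣m-n∣)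
open import Data.Nat.Tactic.RingSolver using (solve-∀)
open import Data.Product using (_×_; _,_)
open import Function using (_∘_)
open import Relation.Binary.PropositionalEquality
  using (_≡_; refl; sym; trans; cong; cong₂; subst; setoid; module ≡-Reasoning)
open import Relation.Nullary using (does)
open import Relation.Nullary.Decidable using (toWitness)

open import Algebra.Properties.Semiring.Sum +-*-semiring
  using (sum; sum-syntax; sum-cong-≗; sum-replicate-zero; ∑-distrib-+; *-distribˡ-sum)

-- Finite sums and balanced functions on `Fin m`.

sum-const : ∀ m c → ∑[ i < m ] c ≡ m * c
sum-const zero    c = refl
sum-const (suc m) c = cong (c +_) (sum-const m c)

sum-mono-≤ : ∀ {m} {f g : Fin m → ℕ} → (∀ i → f i ≤ g i) → sum f ≤ sum g
sum-mono-≤ {zero}  f≤g = z≤n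
sum-mono-≤ {suc m} f≤g = +-mono-≤ (f≤g zero) (sum-mono-≤ (f≤g ∘ suc))

sum-mono-< : ∀ {m} {f g : Fin m → ℕ} → (∀ i → f i ≤ g i) → ∀ i → f i < g i → sum f < sum g
sum-mono-< f≤g zero    f<g = +-mono-<-≤ f<g (sum-mono-≤ (f≤g ∘ suc))
sum-mono-< f≤g (suc i) f<g = +-mono-≤-< (f≤g zero) (sum-mono-< (f≤g ∘ suc) i f<g)

-- Gauss's formula, cleared of the halving and of the subtraction in m(m-1)/2, so that it is a
-- polynomial identity over the semiring of naturals.
sum-toℕ : ∀ m → 2 * ∑[ i < m ] toℕ i + m ≡ m * m
sum-toℕ zero    = refl
sum-toℕ (suc m) = begin
  2 * ∑[ i < m ] suc (toℕ i) + suc m            ≡⟨ cong (λ s → 2 * s + suc m) (∑-distrib-+ {m} (λ _ → 1) toℕ) ⟩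
  2 * (∑[ i < m ] 1 + ∑[ i < m ] toℕ i) + suc m ≡⟨ cong (λ s → 2 * (s + ∑[ i < m ] toℕ i) + suc m) (trans (sum-const m 1) (*-identityʳ m)) ⟩
  2 * (m + ∑[ i < m ] toℕ i) + suc m            ≡⟨ regroup m _ ⟩
  suc (2 * m) + (2 * ∑[ i < m ] toℕ i + m)      ≡⟨ cong (suc (2 * m) +_) (sum-toℕ m) ⟩
  suc (2 * m) + m * m                           ≡⟨ square m ⟩
  suc m * suc m                                 ∎
  where
  open ≡-Reasoning
  regroup : ∀ m s → 2 * (m + s) + suc m ≡ suc (2 * m) + (2 * s + m)
  regroup = solve-∀
  square : ∀ m → suc (2 * m) + m * m ≡ suc m * suc m
  square = solve-∀

-- If f b < f a, then f lies between f b and 1 + f b everywhere, strictly above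
-- the lower bound at a and strictly below the upper one at b, so sum f lies
-- strictly between consecutive multiples of m.
balanced⇒≤ : ∀ {m} (f : Fin m → ℕ) → (∀ a b → ∣ f a - f b ∣ ≤ 1) → m ∣ sum f → ∀ a b → f a ≤ f b
balanced⇒≤ {m} f balanced (divides q sum≡q*m) a b = ≮⇒≥ λ fb<fa →
  let below x = s≤s⁻¹ (≤-trans fb<fa (within a x))
      fb<q    = *-cancelˡ-< m (f b) q (bound₁ (sum-mono-< below a fb<fa))
      q<1+fb  = *-cancelˡ-< m q (suc (f b)) (bound₂ (sum-mono-< (λ x → within x b) b (n<1+n (f b))))
  in ≤⇒≯ fb<q q<1+fb
  where
  within : ∀ x y → f x ≤ suc (f y)
  within x y = ≤-trans (m≤n+∣m-n∣ (f x) (f y))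
    (≤-trans (+-monoʳ-≤ (f y) (balanced x y)) (≤-reflexive (+-comm (f y) 1)))
  sum≡m*q : sum f ≡ m * q
  sum≡m*q = trans sum≡q*m (*-comm q m)
  bound₁ : ∑[ i < m ] f b < sum f → m * f b < m * q
  bound₁ = subst (_< m * q) (sum-const m (f b)) ∘ subst (∑[ i < m ] f b <_) sum≡m*q
  bound₂ : sum f < ∑[ i < m ] suc (f b) → m * q < m * suc (f b)
  bound₂ = subst (_< m * suc (f b)) sum≡m*q ∘ subst (sum f <_) (sum-const m (suc (f b)))

balanced⇒const : ∀ {m} (f : Fin m → ℕ) → (∀ a b → ∣ f a - f b ∣ ≤ 1) → m ∣ sum f → ∀ a b → f a ≡ f b
balanced⇒const f balanced m∣sum a b =
  ≤-antisym (balanced⇒≤ f balanced m∣sum a b) (balanced⇒≤ f balanced m∣sum b a)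

-- Double counting over the fibres of a labeling.

sum-indicator : ∀ {m} (x : Fin m) (g : Fin m → ℕ) → ∑[ a < m ] (if does (x ≟ a) then g a else 0) ≡ g x
sum-indicator {suc m} zero    g = trans (cong (g zero +_) (sum-replicate-zero m)) (+-identityʳ (g zero))
sum-indicator {suc m} (suc x) g = sum-indicator x (g ∘ suc)

-- Each entry x lies in exactly one fibre, the one over `lab x`, and there contributes `g (lab x)`.
-- The weight 1 counts the edges; the weight `toℕ` adds up their labels.
sum-fibres : ∀ {m} {B : Set} (lab : B → Fin m) (g : Fin m → ℕ) (xs : List B) →
             ∑[ a < m ] (length (filter (λ x → lab x ≟ a) xs) * g a) ≡ sumᴸ (map (g ∘ lab) xs)
sum-fibres {m} lab g []       = sum-replicate-zero m
sum-fibres {m} lab g (x ∷ xs) = begin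
  ∑[ a < m ] (length (filter (λ y → lab y ≟ a) (x ∷ xs)) * g a)
    ≡⟨ sum-cong-≗ head-fibre ⟩
  ∑[ a < m ] ((if does (lab x ≟ a) then g a else 0) + length (filter (λ y → lab y ≟ a) xs) * g a)
    ≡⟨ ∑-distrib-+ (λ a → if does (lab x ≟ a) then g a else 0) _ ⟩
  ∑[ a < m ] (if does (lab x ≟ a) then g a else 0) + ∑[ a < m ] (length (filter (λ y → lab y ≟ a) xs) * g a)
    ≡⟨ cong₂ _+_ (sum-indicator (lab x) g) (sum-fibres lab g xs) ⟩
  g (lab x) + sumᴸ (map (g ∘ lab) xs) ∎
  where
  open ≡-Reasoning
  head-fibre : ∀ a → length (filter (λ y → lab y ≟ a) (x ∷ xs)) * g a
                   ≡ (if does (lab x ≟ a) then g a else 0) + length (filter (λ y → lab y ≟ a) xs) * g a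
  -- Both `filter` and `if` branch on this Boolean, so each case holds by computation.
  head-fibre a with does (lab x ≟ a)
  ... | true  = refl
  ... | false = refl

sumᴸ-const : ∀ {B : Set} c (xs : List B) → sumᴸ (map (λ _ → c) xs) ≡ length xs * c
sumᴸ-const c []       = refl
sumᴸ-const c (x ∷ xs) = cong (c +_) (sumᴸ-const c xs)

∣-sumᴸ : ∀ {B : Set} d (w : B → ℕ) → (∀ x → d ∣ w x) → ∀ xs → d ∣ sumᴸ (map w xs)
∣-sumᴸ d w d∣w []       = d ∣0
∣-sumᴸ d w d∣w (x ∷ xs) = ∣m∣n⇒∣m+n (d∣w x) (∣-sumᴸ d w d∣w xs)

-- The edges of the friendship graph, grouped by triangles.

module _ {n : ℕ} where

  rims : List (Fin n) → List (FVertex n)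
  rims ks = cartesianProductWith rim ks (allFin 2)

  rimEdge : Fin n → FVertex n × FVertex n
  rimEdge k = rim k 0F , rim k 1F

  -- The first triangle contributes one pair of its own, in list order; every other pair starting in
  -- it leads to a later triangle and is discarded. Uniqueness of `ks` ensures that those triangles
  -- are different ones.
  rim-edges : ∀ {ks} → Unique ks → filter (λ (u , v) → FAdj? u v) (pairs (rims ks)) ≡ map rimEdge ks
  rim-edges             []            = refl
  rim-edges {k ∷ ks} (k∉ks ∷ unique) = begin
    filter Adj? (rimEdge k ∷ map (rim k 0F ,_) (rims ks) ++ map (rim k 1F ,_) (rims ks) ++ pairs (rims ks))
      ≡⟨ filter-accept Adj? (rim-rim λ ()) ⟩
    rimEdge k ∷ filter Adj? (map (rim k 0F ,_) (rims ks) ++ map (rim k 1F ,_) (rims ks) ++ pairs (rims ks))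
      ≡⟨ cong (rimEdge k ∷_) (trans (skip 0F _) (skip 1F _)) ⟩
    rimEdge k ∷ filter Adj? (pairs (rims ks))
      ≡⟨ cong (rimEdge k ∷_) (rim-edges unique) ⟩
    rimEdge k ∷ map rimEdge ks ∎
    where
    open ≡-Reasoning
    Adj? = λ ((u , v) : FVertex n × FVertex n) → FAdj? u v
    non-adjacent : ∀ i → All (λ v → ¬ FAdj (rim k i) v) (rims ks)
    non-adjacent i = All-cartesianProductWith⁺ (setoid _) (setoid _) rim ks (allFin 2)
      -- Matching on `rim-rim` identifies the second triangle with k, which would then occur again
      -- in `ks`.
      λ { l∈ks _ (rim-rim _) → lookup k∉ks l∈ks refl }
    skip : ∀ i es → filter Adj? (map (rim k i ,_) (rims ks) ++ es) ≡ filter Adj? es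
    skip i es = trans (filter-++ Adj? (map (rim k i ,_) (rims ks)) es)
                      (cong (_++ filter Adj? es) (filter-none Adj? (map⁺ (non-adjacent i))))

  -- The hub heads the vertex list, so `pairs` first lists all hub pairs, which are all edges, and
  -- then the pairs of rim vertices.
  friendship-edges : Graph.edges (friendship n) ≡ map (hub ,_) (rims (allFin n)) ++ map rimEdge (allFin n)
  friendship-edges = trans (filter-++ Adj? (map (hub ,_) (rims (allFin n))) _)
    (cong₂ _++_ (filter-all Adj? (map⁺ hub-adjacent)) (rim-edges (allFin⁺ n)))
    where
    Adj? = λ ((u , v) : FVertex n × FVertex n) → FAdj? u v
    hub-adjacent : All (FAdj hub) (rims (allFin n))
    hub-adjacent = All-cartesianProductWith⁺ (setoid _) (setoid _) rim (allFin n) (allFin 2) λ _ _ → hub-rim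

  triangleSum : (FVertex n × FVertex n → ℕ) → Fin n → ℕ
  triangleSum w k = w (hub , rim k 0F) + w (hub , rim k 1F) + w (rimEdge k)

  -- The spokes come two per triangle and in the same order as the rim edges, so one induction on
  -- `ks` interleaves both sums.
  sum-by-triangles : ∀ w ks → sumᴸ (map w (map (hub ,_) (rims ks))) + sumᴸ (map w (map rimEdge ks))
                            ≡ sumᴸ (map (triangleSum w) ks)
  sum-by-triangles w []       = refl
  sum-by-triangles w (k ∷ ks) = trans (regroup (w (hub , rim k 0F)) (w (hub , rim k 1F)) _ (w (rimEdge k)) _)
                                      (cong (triangleSum w k +_) (sum-by-triangles w ks))
    where
    regroup : ∀ a b s c t → a + (b + s) + (c + t) ≡ a + b + c + (s + t)
    regroup = solve-∀

  sum-edges : ∀ w → sumᴸ (map w (Graph.edges (friendship n))) ≡ sumᴸ (map (triangleSum w) (allFin n))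
  sum-edges w = begin
    sumᴸ (map w (Graph.edges (friendship n)))                   ≡⟨ cong (sumᴸ ∘ map w) friendship-edges ⟩
    sumᴸ (map w (spokes ++ map rimEdge (allFin n)))             ≡⟨ cong sumᴸ (map-++ w spokes _) ⟩
    sumᴸ (map w spokes ++ map w (map rimEdge (allFin n)))       ≡⟨ sum-++ (map w spokes) _ ⟩
    sumᴸ (map w spokes) + sumᴸ (map w (map rimEdge (allFin n))) ≡⟨ sum-by-triangles w (allFin n) ⟩
    sumᴸ (map (triangleSum w) (allFin n))                       ∎
    where
    open ≡-Reasoning
    spokes = map (hub ,_) (rims (allFin n))

-- Divisibility of the sum of the edge labels.

triangle-even : ∀ m .{{_ : NonZero m}} → 2 ∣ m → ∀ (h x y : Fin m) →
                2 ∣ toℕ (addMod m h x) + toℕ (addMod m h y) + toℕ (addMod m x y)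
triangle-even m 2∣m h x y = ∣m+n∣m⇒∣n
  (subst (2 ∣_) total (m∣m*n (toℕ h + toℕ x + toℕ y)))
  (∣n⇒∣m*n (carry h x + carry h y + carry x y) 2∣m)
  where
  open ≡-Reasoning
  -- How often m is subtracted when the sum of two residues is reduced: 0 or 1 times.
  carry : Fin m → Fin m → ℕ
  carry i j = (toℕ i + toℕ j) / m
  with-carry : ∀ i j → toℕ i + toℕ j ≡ toℕ (addMod m i j) + carry i j * m
  with-carry i j = trans (m≡m%n+[m/n]*n (toℕ i + toℕ j) m)
    (cong (_+ carry i j * m) (sym (toℕ-fromℕ< (m%n<n (toℕ i + toℕ j) m))))
  double : ∀ a b c → 2 * (a + b + c) ≡ (a + b) + (a + c) + (b + c)
  double = solve-∀
  regroup : ∀ a b c p q r m → (a + p * m) + (b + q * m) + (c + r * m) ≡ (p + q + r) * m + (a + b + c)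
  regroup = solve-∀
  total : 2 * (toℕ h + toℕ x + toℕ y)
        ≡ (carry h x + carry h y + carry x y) * m + (toℕ (addMod m h x) + toℕ (addMod m h y) + toℕ (addMod m x y))
  total = begin
    2 * (toℕ h + toℕ x + toℕ y)
      ≡⟨ double (toℕ h) (toℕ x) (toℕ y) ⟩
    (toℕ h + toℕ x) + (toℕ h + toℕ y) + (toℕ x + toℕ y)
      ≡⟨ cong₂ _+_ (cong₂ _+_ (with-carry h x) (with-carry h y)) (with-carry x y) ⟩
    (toℕ (addMod m h x) + carry h x * m) + (toℕ (addMod m h y) + carry h y * m) + (toℕ (addMod m x y) + carry x y * m)
      ≡⟨ regroup (toℕ (addMod m h x)) (toℕ (addMod m h y)) (toℕ (addMod m x y)) (carry h x) (carry h y) (carry x y) m ⟩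
    (carry h x + carry h y + carry x y) * m + (toℕ (addMod m h x) + toℕ (addMod m h y) + toℕ (addMod m x y)) ∎

theorem7p1 : (m n : ℕ) .{{_ : NonZero m}} → 2 ∣ m → 2 ∣ n → m ∣ 3 * n → 4 ∤ n → ¬ Cordial (ℤ/ m) _≟_ (friendship n)
theorem7p1 m n 2∣m 2∣n m∣3n 4∤n (lab , _ , balanced) =
  -- 4 and 3 are coprime, which is decided by evaluation, so 4 can be cancelled past the factor 3.
  4∤n (coprime-divisor (toWitness {a? = coprime? 4 3} _) 4∣3n)
  where
  open ≡-Reasoning
  edgeLabel : FVertex n × FVertex n → Fin m
  edgeLabel (u , v) = addMod m (lab u) (lab v)

  f : Fin m → ℕ
  f = f-E (ℤ/ m) _≟_ (friendship n) lab

  q S : ℕ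
  -- The common value of `f`, read off at a residue that exists because m is nonzero.
  q = f (0 mod m)
  S = sumᴸ (map (toℕ ∘ edgeLabel) (Graph.edges (friendship n)))

  sum-f : sum f ≡ 3 * n
  sum-f = begin
    sum f                                             ≡⟨ sum-cong-≗ (λ a → *-identityʳ (f a)) ⟨
    ∑[ a < m ] (f a * 1)                              ≡⟨ sum-fibres edgeLabel (λ _ → 1) (Graph.edges (friendship n)) ⟩
    sumᴸ (map (λ _ → 1) (Graph.edges (friendship n))) ≡⟨ sum-edges {n} (λ _ → 1) ⟩
    -- With weight 1 on every edge, `triangleSum` evaluates to 3.
    sumᴸ (map (λ _ → 3) (allFin n))                   ≡⟨ sumᴸ-const 3 (allFin n) ⟩
    length (allFin n) * 3                             ≡⟨ cong (_* 3) (length-tabulate {n = n} (λ i → i)) ⟩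
    n * 3                                             ≡⟨ *-comm n 3 ⟩
    3 * n                                             ∎

  f≡q : ∀ a → f a ≡ q
  f≡q a = balanced⇒const f balanced (subst (m ∣_) (sym sum-f) m∣3n) a (0 mod m)

  m*q≡3n : m * q ≡ 3 * n
  m*q≡3n = trans (sym (trans (sum-cong-≗ f≡q) (sum-const m q))) sum-f

  S≡q*sum : S ≡ q * ∑[ a < m ] toℕ a
  S≡q*sum = begin
    S                        ≡⟨ sum-fibres edgeLabel toℕ (Graph.edges (friendship n)) ⟨
    ∑[ a < m ] (f a * toℕ a) ≡⟨ sum-cong-≗ (λ a → cong (_* toℕ a) (f≡q a)) ⟩
    ∑[ a < m ] (q * toℕ a)   ≡⟨ *-distribˡ-sum q (toℕ {m}) ⟨
    q * ∑[ a < m ] toℕ a     ∎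

  2S+3n≡3nm : 2 * S + 3 * n ≡ 3 * (n * m)
  2S+3n≡3nm = begin
    -- Writing `3 * n` as `m * q` gives both summands the factor q and leaves the left side of
    -- `sum-toℕ` as cofactor.
    2 * S + 3 * n                      ≡⟨ cong₂ (λ s t → 2 * s + t) S≡q*sum (sym m*q≡3n) ⟩
    2 * (q * ∑[ a < m ] toℕ a) + m * q ≡⟨ factor q (∑[ a < m ] toℕ a) m ⟩
    q * (2 * ∑[ a < m ] toℕ a + m)     ≡⟨ cong (q *_) (sum-toℕ m) ⟩
    q * (m * m)                        ≡⟨ assoc q m ⟩
    m * q * m                          ≡⟨ cong (_* m) m*q≡3n ⟩
    3 * n * m                          ≡⟨ *-assoc 3 n m ⟩
    3 * (n * m)                        ∎
    where
    factor : ∀ q s m → 2 * (q * s) + m * q ≡ q * (2 * s + m)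
    factor = solve-∀
    assoc : ∀ q m → q * (m * m) ≡ m * q * m
    assoc = solve-∀

  2∣S : 2 ∣ S
  2∣S = subst (2 ∣_) (sym (sum-edges (toℕ ∘ edgeLabel)))
    (∣-sumᴸ 2 (triangleSum (toℕ ∘ edgeLabel)) (λ k → triangle-even m 2∣m (lab hub) (lab (rim k 0F)) (lab (rim k 1F))) (allFin n))

  4∣3n : 4 ∣ 3 * n
  -- 4 divides the whole sum because n and m are both even, and it divides `2 * S` because S is
  -- even; hence it divides the other summand.
  4∣3n = ∣m+n∣m⇒∣n (subst (4 ∣_) (sym 2S+3n≡3nm) (∣n⇒∣m*n 3 (*-pres-∣ 2∣n 2∣m))) (*-monoʳ-∣ 2 2∣S)
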